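{- Let $\mathcal{S}$ be a structural abstract logic in a propositional language $\mathcal{L}$ that is determined by a nonempty set $\mathcal{M}=\{\mathbf{M}_j\}_{j\in J}$ of $\mathcal{L}$-matrices (i.e. $\vdash_{\mathcal{S}}\,=\,\vdash_{\mathcal{M}}$). The logic $\mathcal{S}$ is couniform if, and only if, for any collection $\{X_i\}_{i\in I}$ of sets of $\mathcal{L}$-formulae with $\mathcal{V}(X_i)\cap\mathcal{V}(X_{i'})=\varnothing$ whenever $i\neq i'$, and with $\mathcal{V}(\bigcup_{i\in I}X_i)\neq\mathcal{V}_{\mathcal{L}}$, the following condition is satisfied: if for every $i\in I$ there are $j\in J$ and $Z_j\in\mathfrak{S}(\mathbf{M}_j)$ with $X_i\subseteq Z_j\subsetneq\mathbf{Fm}_{\mathcal{L}}$, then there are $k\in J$ and $Z_k\in\mathfrak{S}(\mathbf{M}_k)$ with $\bigcup_{i\in I}X_i\subseteq Z_k\subsetneq\mathbf{Fm}_{\mathcal{L}}$.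
   Context: $\mathcal{L}$ is an abstract propositional language, given by a set $\mathcal{V}_{\mathcal{L}}$ of variables, a set of constants and a set of finitary connectives. $\mathbf{Fm}_{\mathcal{L}}$ is the set of all $\mathcal{L}$-formulae; $\mathcal{V}(\alpha)$ is the set of variables occurring in $\alpha$, and $\mathcal{V}(X)=\bigcup_{\alpha\in X}\mathcal{V}(\alpha)$ for $X\subseteq\mathbf{Fm}_{\mathcal{L}}$. A structural abstract logic $\mathcal{S}$ is given by a (not necessarily finitary) consequence relation $\vdash_{\mathcal{S}}$ on $\mathbf{Fm}_{\mathcal{L}}$ (reflexive, monotone, transitive/closed under cut) closed under substitutions, equivalently by its consequence operator $\mathbf{Cn}_{\mathcal{S}}(X)=\{\alpha : X\vdash_{\mathcal{S}}\alpha\}$. A set $X$ is consistent if $\mathbf{Cn}_{\mathcal{S}}(X)\neq\mathbf{Fm}_{\mathcal{L}}$. $\mathcal{S}$ is couniform if for any collection $\{X_i\}_{i\in I}$ of formula sets with $\mathcal{V}(X_i)\cap\mathcal{V}(X_{i'})=\varnothing$ for $i\neq i'$ and $\mathcal{V}(\bigcup_{i\in I}X_i)\neq\mathcal{V}_{\mathcal{L}}$: if $\bigcup_{i\in I}X_i$ is inconsistent, then at least one $X_i$ is inconsistent. An $\mathcal{L}$-matrix is a pair $\mathbf{M}=\langle\mathbf{A},D\rangle$ with $\mathbf{A}$ an algebra of the signature of $\mathcal{L}$ and $D\subseteq|\mathbf{A}|$. $X\models_{\mathbf{M}}\alpha$ means: for every valuation $v$ in $\mathbf{A}$ (homomorphism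 from the formula algebra to $\mathbf{A}$), if $v[X]\subseteq D$ then $v[\alpha]\in D$. For a nonempty set $\mathcal{M}=\{\mathbf{M}_j\}_{j\in J}$, $X\vdash_{\mathcal{M}}\alpha$ iff $X\models_{\mathbf{M}_j}\alpha$ for each $j\in J$. $\mathfrak{S}(\mathbf{M})$, for $\mathbf{M}=\langle\mathbf{A},D\rangle$, is the set of all $X\subseteq\mathbf{Fm}_{\mathcal{L}}$ such that $X=\{\alpha\in\mathbf{Fm}_{\mathcal{L}} : v[\alpha]\in D\}$ for some valuation $v$ in $\mathbf{A}$. -}

module Defs where

open import Level using (Level; suc)
open import Data.Nat.Base using (ℕ)
open import Data.Product.Base using (∃; _×_; _,_)
open import Data.Vec.Base using (Vec; map)
open import Data.Vec.Relation.Unary.Any using (Any)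
open import Function.Bundles using (_⇔_)
open import Relation.Binary.PropositionalEquality.Core using (_≡_; _≢_)
open import Relation.Nullary.Negation.Core using (¬_)
open import Relation.Unary using (Pred; _∈_; _⊆_; _≐_; _⊥_; U; ⋃)

-- Sets of formulae are predicates.  All sorts, predicates and index sets live
-- in one arbitrary universe Set ℓ, so that small unions, images and the
-- consequence relation of a family of matrices stay in Set ℓ.

_[_] : ∀ {ℓ} {A B : Set ℓ} → (A → B) → Pred A ℓ → Pred B ℓ
f [ X ] = λ b → ∃ λ a → a ∈ X × b ≡ f a

record Language (ℓ : Level) : Set (suc ℓ) where
  field
    Var        : Set ℓ
    Const      : Set ℓ
    Connective : Set ℓ
    arity      : Connective → ℕ

module _ {ℓ : Level} (L : Language ℓ) where
  open Language L

  data Fm : Set ℓ where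
    var   : Var → Fm
    const : Const → Fm
    conn  : (c : Connective) → Vec Fm (arity c) → Fm

  record Algebra : Set (suc ℓ) where
    field
      Carrier : Set ℓ
      ⟦const⟧ : Const → Carrier
      ⟦conn⟧  : (c : Connective) → Vec Carrier (arity c) → Carrier

module _ {ℓ : Level} {L : Language ℓ} where
  open Language L

  data _OccursIn_ (p : Var) : Fm L → Set ℓ where
    here  : p OccursIn var p
    there : ∀ {c αs} → Any (p OccursIn_) αs → p OccursIn conn c αs

  𝒱 : Pred (Fm L) ℓ → Pred Var ℓ
  𝒱 X = λ p → ∃ λ α → α ∈ X × p OccursIn α

  𝐅𝐦 : Algebra L
  𝐅𝐦 = record { Carrier = Fm L ; ⟦const⟧ = const ; ⟦conn⟧ = conn }

  record Hom (𝐀 𝐁 : Algebra L) : Set ℓ where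
    private
      module A = Algebra 𝐀
      module B = Algebra 𝐁
    field
      fun       : A.Carrier → B.Carrier
      fun-const : ∀ k → fun (A.⟦const⟧ k) ≡ B.⟦const⟧ k
      fun-conn  : ∀ c as → fun (A.⟦conn⟧ c as) ≡ B.⟦conn⟧ c (map fun as)

  open Hom public using (fun)

  Valuation : Algebra L → Set ℓ
  Valuation 𝐀 = Hom 𝐅𝐦 𝐀

  Substitution : Set ℓ
  Substitution = Hom 𝐅𝐦 𝐅𝐦

module _ {ℓ : Level} (L : Language ℓ) where

  record StructuralLogic : Set (suc ℓ) where
    infix 4 _⊢_
    field
      _⊢_        : Pred (Fm L) ℓ → Fm L → Set ℓ
      reflexive  : ∀ {X α} → α ∈ X → X ⊢ α
      monotone   : ∀ {X Y α} → X ⊆ Y → X ⊢ α → Y ⊢ α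
      transitive : ∀ {X Y α} → (∀ {β} → β ∈ Y → X ⊢ β) → Y ⊢ α → X ⊢ α
      structural : ∀ {X α} (σ : Substitution) →
                   X ⊢ α → (fun σ [ X ]) ⊢ fun σ α

    Cn : Pred (Fm L) ℓ → Pred (Fm L) ℓ
    Cn X = λ α → X ⊢ α

    Inconsistent : Pred (Fm L) ℓ → Set ℓ
    Inconsistent X = Cn X ≐ U

    Consistent : Pred (Fm L) ℓ → Set ℓ
    Consistent X = ¬ Inconsistent X

  record Matrix : Set (suc ℓ) where
    field
      𝐀 : Algebra L
      D : Pred (Algebra.Carrier 𝐀) ℓ

module _ {ℓ : Level} {L : Language ℓ} where
  open Language L

  Couniform : StructuralLogic L → Set (suc ℓ)
  Couniform S =
    (I : Set ℓ) (X : I → Pred (Fm L) ℓ) →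
    (∀ i i′ → i ≢ i′ → 𝒱 (X i) ⊥ 𝒱 (X i′)) →
    ¬ (𝒱 (⋃ I X) ≐ U) →
    Inconsistent (⋃ I X) → ∃ λ i → Inconsistent (X i)
    where open StructuralLogic S

  infix 4 _⊨[_]_

  _⊨[_]_ : Pred (Fm L) ℓ → Matrix L → Fm L → Set ℓ
  X ⊨[ M ] α = (v : Valuation 𝐀) → (fun v [ X ]) ⊆ D → fun v α ∈ D
    where open Matrix M

  DeterminedBy : StructuralLogic L → {J : Set ℓ} → (J → Matrix L) → Set (suc ℓ)
  DeterminedBy S M = ∀ X α → (X ⊢ α) ⇔ (∀ j → X ⊨[ M j ] α)
    where open StructuralLogic S

  𝔖 : Matrix L → Pred (Pred (Fm L) ℓ) ℓ
  𝔖 M = λ X → ∃ λ (v : Valuation 𝐀) → X ≐ (λ α → fun v α ∈ D)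
    where open Matrix M

{-# OPTIONS --safe #-}
module Submission where

-- A set X is consistent exactly when it lies in some proper Z ∈ 𝔖 (M j): a
-- formula not derivable from X is refuted by a valuation v satisfying X, and
-- Z = {α : v[α] ∈ D} is the required set.  The two sides of the equivalence are
-- then contrapositives of each other.

open import Defs
open import Axiom.ExcludedMiddle using (ExcludedMiddle)
open import Data.Product.Base using (∃; _×_; _,_)
open import Data.Unit.Base using (tt)
open import Function.Bundles using (_⇔_; mk⇔; Equivalence)
open import Relation.Binary.PropositionalEquality.Core using (_≢_; refl)
open import Relation.Nullary.Decidable.Core using (decidable-stable)
open import Relation.Nullary.Negation.Core using (¬_)
open import Relation.Unary using (Pred; _∈_; _⊆_; _⊂_; _≐_; _⊥_; U; ⋃)

module _ {ℓ} {L : Language ℓ} {J : Set ℓ} (M : J → Matrix L) where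

  -- Quantifying over valuations instead of sets Z keeps this in Set ℓ, where
  -- excluded middle is available.
  ProperlySatisfiable : Pred (Fm L) ℓ → Set ℓ
  ProperlySatisfiable X = ∃ λ j → let open Matrix (M j) in
    ∃ λ (v : Valuation 𝐀) → (∀ {α} → α ∈ X → fun v α ∈ D) × ¬ (∀ α → fun v α ∈ D)

  InProperTheory : Pred (Fm L) ℓ → Set _
  InProperTheory X = ∃ λ j → ∃ λ Z → Z ∈ 𝔖 (M j) × X ⊆ Z × Z ⊂ U

  properlySatisfiable⇒inProperTheory : ∀ {X} → ProperlySatisfiable X → InProperTheory X
  properlySatisfiable⇒inProperTheory (j , v , v⊨X , proper) =
    -- The underscore is solved to the truth set of `v`, so both inclusions needed for membership in
    -- `𝔖` are identities.
    j , _ , (v , (λ p → p) , (λ p → p)) , v⊨X , (λ _ → tt) , λ U⊆Z → proper (λ _ → U⊆Z tt)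

  inProperTheory⇒properlySatisfiable : ∀ {X} → InProperTheory X → ProperlySatisfiable X
  inProperTheory⇒properlySatisfiable (j , Z , (v , Z⊆v , v⊆Z) , X⊆Z , _ , U⊈Z) =
    j , v , (λ α∈X → Z⊆v (X⊆Z α∈X)) , λ all → U⊈Z (λ {α} _ → v⊆Z (all α))

  module _ (S : StructuralLogic L) (determined : DeterminedBy S M) where
    open StructuralLogic S

    -- Soundness: were every formula derivable from `X`, the valuation satisfying `X` would send all
    -- formulae into `D`.
    properlySatisfiable⇒consistent : ∀ {X} → ProperlySatisfiable X → Consistent X
    properlySatisfiable⇒consistent {X} (j , v , v⊨X , proper) (_ , U⊆Cn) =
      proper λ α → Equivalence.to (determined X α) (U⊆Cn tt) j v λ { (_ , α∈X , refl) → v⊨X α∈X }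

    -- Completeness: a valuation satisfying `X` and refuting some `α` would itself witness
    -- `ProperlySatisfiable X`.
    unsatisfiable⇒inconsistent : ExcludedMiddle ℓ →
      ∀ {X} → ¬ ProperlySatisfiable X → Inconsistent X
    unsatisfiable⇒inconsistent em {X} ¬sat = (λ _ → tt) , λ {α} _ →
      Equivalence.from (determined X α) λ j v v[X]⊆D → decidable-stable em λ vα∉D →
        ¬sat (j , v , (λ α∈X → v[X]⊆D (_ , α∈X , refl)) , λ all → vα∉D (all α))

proposition3p1 : ∀ {ℓ} → ExcludedMiddle ℓ →
    (L : Language ℓ) (S : StructuralLogic L)
    (J : Set ℓ) → J → (M : J → Matrix L) →
    DeterminedBy S M →
    Couniform S ⇔
    ((I : Set ℓ) (X : I → Pred (Fm L) ℓ) →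
    (∀ i i′ → i ≢ i′ → 𝒱 (X i) ⊥ 𝒱 (X i′)) →
    ¬ (𝒱 (⋃ I X) ≐ U) →
    (∀ i → ∃ λ j → ∃ λ Z → Z ∈ 𝔖 (M j) × X i ⊆ Z × Z ⊂ U) →
    ∃ λ k → ∃ λ Z → Z ∈ 𝔖 (M k) × ⋃ I X ⊆ Z × Z ⊂ U)
proposition3p1 em L S J _ M determined = mk⇔ {A = Couniform S}
  (λ couniform I X disjoint fresh theories →
    -- If the union had no proper model, `couniform` would make some `X i` inconsistent, against
    -- `theories i`.
    properlySatisfiable⇒inProperTheory M (decidable-stable em λ ¬sat →
      let i , inconsistent = couniform I X disjoint fresh
                               (unsatisfiable⇒inconsistent M S determined em ¬sat)
      in properlySatisfiable⇒consistent M S determined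
           (inProperTheory⇒properlySatisfiable M (theories i)) inconsistent))
  (λ condition I X disjoint fresh inconsistent →
    -- If no `X i` is inconsistent, each has a proper model, so `condition` makes the union
    -- consistent.
    decidable-stable em λ ¬some →
      properlySatisfiable⇒consistent M S determined
        (inProperTheory⇒properlySatisfiable M
          (condition I X disjoint fresh λ i →
            properlySatisfiable⇒inProperTheory M (decidable-stable em λ ¬sat →
              ¬some (i , unsatisfiable⇒inconsistent M S determined em ¬sat))))
        inconsistent)
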